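{- Any Resolution refutation of $\mathrm{RLNP}_n$ has size $2^{\Omega(n)}$; that is, there is a constant $c>0$ such that for all sufficiently large $n$, every Resolution refutation of $\mathrm{RLNP}_n$ has size at least $2^{cn}$.
   Context: Notation: $[n]=\{1,\dots,n\}$. A clause is a disjunction of literals (propositional variables or their negations). Resolution (also denoted $\mathrm{Res}(1)$): from clauses $\mathcal P\vee x$ and $\mathcal Q\vee\neg x$ derive $\mathcal P\vee\mathcal Q$ (resolution rule); from $\mathcal P$ derive $\mathcal P\vee\ell$ for any literal $\ell$ (weakening). A Resolution refutation of a set of clauses is a derivation of the empty clause from these clauses (axioms), viewed as a directed acyclic graph whose sources are axioms and whose only sink is the empty clause. Its size is the number of internal nodes, i.e. the number of rule applications. The contradiction $\mathrm{RLNP}_n$ (relativized Least number principle). Variables: $R_i$ for $i\in[n]$, and $L_{i,j}$, $S_{i,j}$ for $i,j\in[n]$. The clauses are: $\neg R_i\vee\neg L_{i,i}$ for $i\in[n]$; $\neg R_i\vee\neg R_j\vee\neg R_\ell\vee\neg L_{i,j}\vee\neg L_{j,\ell}\vee L_{i,\ell}$ for $i,j,\ell\in[n]$; $\bigvee_{i\in[n]}S_{i,j}$ for $j\in[n]$; $\neg S_{i,j}\vee\neg R_j\vee R_i$ for $i,j\in[n]$; $\neg S_{i,j}\vee\neg R_j\vee L_{i,j}$ for $i,j\in[n]$; $R_n$. -}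

module Defs where

open import Data.Fin using (Fin; toℕ) renaming (_<_ to _<ᶠ_)
open import Data.Integer using (∣_∣)
open import Data.List using (List; []; _∷_; _++_; tabulate)
open import Data.List.Membership.Propositional using (_∈_; _∉_)
open import Data.List.Relation.Binary.BagAndSetEquality using (_∼[_]_; set)
open import Data.Nat using (ℕ; suc; _*_; _^_; _≤_)
open import Data.Rational using (ℚ; ↥_; ↧ₙ_)
open import Relation.Binary.PropositionalEquality using (_≡_)

data Literal (V : Set) : Set where
  pos neg : V → Literal V

-- Clauses are sets of literals: lists compared by set equality
-- (order and repetition of literals are irrelevant).
Clause : Set → Set
Clause V = List (Literal V)

infix 4 _≈_
_≈_ : {V : Set} → Clause V → Clause V → Set
C ≈ D = C ∼[ set ] D

data Inference {V N : Set} (clause : N → Clause V) (E : Clause V) : Set where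
  resolution : (p q : N) (P Q : Clause V) (x : V) →
               clause p ≈ pos x ∷ P → clause q ≈ neg x ∷ Q →
               E ≈ P ++ Q → Inference clause E
  weakening  : (p : N) (ℓ : Literal V) →
               E ≈ ℓ ∷ clause p → Inference clause E

premises : {V N : Set} {clause : N → Clause V} {E : Clause V} →
           Inference clause E → List N
premises (resolution p q _ _ _ _ _ _) = p ∷ q ∷ []
premises (weakening p _ _)            = p ∷ []

data Node {V : Set} (Axiom : Clause V → Set) (s : ℕ) : Set where
  source   : ∀ {C} → Axiom C → Node Axiom s
  internal : Fin s → Node Axiom s

clauseAt : ∀ {V s} {Axiom : Clause V → Set} →
           (Fin s → Clause V) → Node Axiom s → Clause V
clauseAt label (source {C} _) = C
clauseAt label (internal i)   = label i

record Refutation {V : Set} (Axiom : Clause V → Set) : Set where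
  field
    size  : ℕ
    label : Fin size → Clause V
    rule  : (i : Fin size) →
            Inference (clauseAt {Axiom = Axiom} label) (label i)
    -- The internal nodes are numbered in a topological order.
    acyclic : ∀ {i j} → internal j ∈ premises (rule i) → j <ᶠ i

  Sink : Node Axiom size → Set
  Sink v = ∀ i → v ∉ premises (rule i)

  -- An axiom used nowhere is not part of the graph, so `only-sink` concerns
  -- internal nodes only.  The root is a source only if an axiom is empty.
  field
    root       : Node Axiom size
    root-empty : clauseAt label root ≡ []
    root-sink  : Sink root
    only-sink  : ∀ j → Sink (internal j) → internal j ≡ root

data Var (n : ℕ) : Set where
  R   : Fin n → Var n
  L S : Fin n → Fin n → Var n

data RLNP (n : ℕ) : Clause (Var n) → Set where
  irreflexive : ∀ i → RLNP n (neg (R i) ∷ neg (L i i) ∷ [])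
  transitive  : ∀ i j ℓ → RLNP n
    (neg (R i) ∷ neg (R j) ∷ neg (R ℓ) ∷
     neg (L i j) ∷ neg (L j ℓ) ∷ pos (L i ℓ) ∷ [])
  witness     : ∀ j → RLNP n (tabulate λ i → pos (S i j))
  relativized : ∀ i j → RLNP n (neg (S i j) ∷ neg (R j) ∷ pos (R i) ∷ [])
  smaller     : ∀ i j → RLNP n (neg (S i j) ∷ neg (R j) ∷ pos (L i j) ∷ [])
  -- `Fin n` counts from 0, so the element n of [n] is the i with toℕ i = n - 1.
  nonempty    : ∀ i → suc (toℕ i) ≡ n → RLNP n (pos (R i) ∷ [])

-- For c = p/q > 0, the inequality 2^(c n) ≤ s with both sides raised to the
-- q-th power.  Every positive real lies above a positive rational, so the
-- existence of a constant c > 0 is the same over the reals as over ℚ.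
2^[_·_]≤_ : ℚ → ℕ → ℕ → Set
2^[ c · n ]≤ s = 2 ^ (∣ ↥ c ∣ * n) ≤ s ^ ↧ₙ c

{-# OPTIONS --safe #-}

-- Draw for every element a state: kept (R true) or dropped, with two random
-- bits.  The states fix R, every L i j with i or j dropped, and every S i j with
-- j dropped, or with j kept and i dropped; what is left is the least number
-- principle on the kept elements.  A clause touching many elements survives with
-- exponentially small probability.  Two orders are needed to extract independence
-- from many touched elements: each variable touches at most two elements, so
-- either the larger or the smaller ends are numerous, and one exposes the states
-- in increasing or in decreasing order accordingly.
--
-- Conversely, suppose many elements are kept and every clause touching many
-- elements is satisfied.  Rank the kept elements so that every one but the bottom
-- has a witness further down, and walk from the root towards the axioms along
-- clauses falsified by this assignment, keeping the bottom untouched: before each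
-- resolution step move a fresh kept element to the bottom and make it the witness
-- of the old bottom, which changes no variable of the current clause.  The walk
-- ends in an axiom, and axioms not touching the bottom hold.  So for every choice
-- of states either few elements are kept or some wide clause survives, and a
-- union bound gives the size.
module Submission where

open import Algebra.Properties.CommutativeSemigroup using (interchange)
open import Data.Bool as Bool using (Bool; true; false; not; _∧_; _∨_; _xor_; if_then_else_; T)
open import Data.Bool.ListAction using (any)
open import Data.Bool.Properties
  using (T-≡; ¬-not; not-injective; ∧-zeroʳ; xor-assoc; xor-identityʳ; xor-same)
open import Data.Empty using (⊥)
open import Data.Fin using (Fin; zero; suc; toℕ; fromℕ; _≟_)
  renaming (_<_ to _<ᶠ_; _>_ to _>ᶠ_)
open import Data.Fin.Induction using () renaming (<-wellFounded to <ᶠ-wellFounded)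
open import Data.Fin.Properties using (toℕ-fromℕ; toℕ-injective)
  renaming (any? to anyFin?; ¬∀⟶∃¬ to ¬∀⇒∃¬)
open import Data.Fin.Subset using (Subset; inside; outside; ∣_∣; ⁅_⁆; _∪_)
  renaming (_∈_ to _∈ˢ_; _∉_ to _∉ˢ_)
open import Data.Fin.Subset.Properties
  using (_∈?_; p⊆q⇒∣p∣≤∣q∣; x∈p∪q⁺; x∈⁅x⁆; ∣p∣≤∣x∷p∣; ∣⁅x⁆∣≡1)
import Data.Integer as ℤ
open import Data.List using (List; []; _∷_; _++_; allFin; cartesianProduct; length; map)
open import Data.List.Membership.Propositional using (_∈_; find; lose)
open import Data.List.Membership.Propositional.Properties
  using (∈-++⁺ˡ; ∈-++⁺ʳ; ∈-allFin; ∈-cartesianProduct⁺; ∈-tabulate⁺)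
open import Data.List.Properties using (length-tabulate)
open import Data.List.Relation.Unary.Any using (Any; any?; here; there)
open import Data.Maybe using (Maybe; fromMaybe; just; nothing)
open import Data.Nat hiding (_≟_)
open import Data.Nat.DivMod using (/-monoˡ-≤; m%n<n; m≡m%n+[m/n]*n)
open import Data.Nat.ListAction using (sum)
open import Data.Nat.Properties hiding (_≟_)
open import Data.Nat.Tactic.RingSolver using (solve-∀)
open import Data.Product using (Σ-syntax; ∃; _×_; _,_; proj₁; proj₂)
open import Data.Rational as ℚ using (ℚ; Positive)
open import Data.Sum using (_⊎_; inj₁; inj₂)
open import Data.Vec using (Vec; []; _∷_; here; lookup; replicate; tabulate; there)
  renaming (map to mapᵛ)
open import Data.Vec.Functional using (updateAt)
open import Data.Vec.Functional.Properties using (updateAt-minimal; updateAt-updates)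
open import Data.Vec.Properties using ([]=⇒lookup; lookup-map; lookup∘tabulate; lookup⇒[]=)
open import Function using (Equivalence; const; _∘_)
open import Induction.WellFounded using (Acc; acc)
open import Relation.Binary.PropositionalEquality
open import Relation.Nullary
  using (Dec; Reflects; ¬_; contradiction; does; invert; no; proof; yes; ¬?; _×-dec_; _→-dec_)
open import Relation.Nullary.Decidable using (dec-false; dec-true; decidable-stable)
open import Defs

open Equivalence using (from; to)

private variable
  A : Set
  n : ℕ

-- Finite sums and indicators

∑ : List A → (A → ℕ) → ℕ
∑ xs f = sum (map f xs)

∑-mono : ∀ (xs : List A) {f g : A → ℕ} → (∀ x → f x ≤ g x) → ∑ xs f ≤ ∑ xs g
∑-mono []       f≤g = z≤n
∑-mono (x ∷ xs) f≤g = +-mono-≤ (f≤g x) (∑-mono xs f≤g)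

∑-+ : ∀ (xs : List A) (f g : A → ℕ) → ∑ xs (λ x → f x + g x) ≡ ∑ xs f + ∑ xs g
∑-+ []       f g = refl
∑-+ (x ∷ xs) f g =
  trans (cong (f x + g x +_) (∑-+ xs f g)) (interchange +-commutativeSemigroup (f x) (g x) _ _)

∑-*ˡ : ∀ c (xs : List A) (f : A → ℕ) → ∑ xs (λ x → c * f x) ≡ c * ∑ xs f
∑-*ˡ c []       f = sym (*-zeroʳ c)
∑-*ˡ c (x ∷ xs) f =
  trans (cong (c * f x +_) (∑-*ˡ c xs f)) (sym (*-distribˡ-+ c (f x) _))

∑-≤ : ∀ {c B} (xs : List A) (f : A → ℕ) → (∀ x → f x * c ≤ B) →
      ∑ xs f * c ≤ length xs * B
∑-≤ []       f f≤ = z≤n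
∑-≤ {c = c} (x ∷ xs) f f≤ rewrite *-distribʳ-+ c (f x) (∑ xs f) =
  +-mono-≤ (f≤ x) (∑-≤ xs f f≤)

-- Subtraction-free form of a bound with one summand fewer: the share `B` of the vanishing term is
-- added on the left.
∑-≤-vanishing : ∀ {c B} {xs : List A} {x} (f : A → ℕ) → x ∈ xs → f x ≡ 0 →
                (∀ y → f y * c ≤ B) → B + ∑ xs f * c ≤ length xs * B
∑-≤-vanishing {B = B} {xs = y ∷ xs} f (here refl) fx≡0 f≤ rewrite fx≡0 =
  +-monoʳ-≤ B (∑-≤ xs f f≤)
∑-≤-vanishing {c = c} {B} {y ∷ xs} f (there x∈xs) fx≡0 f≤ = begin
  B + (f y + ∑ xs f) * c      ≡⟨ lemma B (f y) (∑ xs f) c ⟩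
  f y * c + (B + ∑ xs f * c)  ≤⟨ +-mono-≤ (f≤ y) (∑-≤-vanishing f x∈xs fx≡0 f≤) ⟩
  B + length xs * B           ∎
  where
  open ≤-Reasoning
  lemma : ∀ B u v c → B + (u + v) * c ≡ u * c + (B + v * c)
  lemma = solve-∀

∈⇒≤∑ : ∀ {xs : List A} {x} (f : A → ℕ) → x ∈ xs → f x ≤ ∑ xs f
∈⇒≤∑ f (here refl)  = m≤m+n _ _
∈⇒≤∑ f (there x∈xs) = ≤-trans (∈⇒≤∑ f x∈xs) (m≤n+m _ _)

any-∈ : ∀ (p : A → Bool) {xs x} → x ∈ xs → p x ≡ true → any p xs ≡ true
any-∈ p (here refl) px rewrite px = refl
any-∈ p {y ∷ _} (there x∈xs) px with p y
... | true  = refl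
... | false = any-∈ p x∈xs px

any-none : ∀ (p : A → Bool) xs → (∀ {x} → x ∈ xs → p x ≡ false) → any p xs ≡ false
any-none p []       none = refl
any-none p (x ∷ xs) none rewrite none (here refl) = any-none p xs (none ∘ there)

𝟙 : Bool → ℕ
𝟙 b = if b then 1 else 0

𝟙≤1 : ∀ b → 𝟙 b ≤ 1
𝟙≤1 true  = ≤-refl
𝟙≤1 false = z≤n

𝟙-mono : ∀ {b c} → (b ≡ true → c ≡ true) → 𝟙 b ≤ 𝟙 c
𝟙-mono {false} b⇒c = z≤n
𝟙-mono {true}  b⇒c rewrite b⇒c refl = ≤-refl

-- Counting over independent uniform states

State : Set
State = Bool × Bool × Bool

-- With a single bit per element, `L i i` would be that bit xored with itself, hence constant; two
-- bits let a dropped element set it either way.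
kept row column : State → Bool
kept   = proj₁
row    = proj₁ ∘ proj₂
column = proj₂ ∘ proj₂

states : List State
states = cartesianProduct bools (cartesianProduct bools bools)
  where bools = true ∷ false ∷ []

∈-states : ∀ s → s ∈ states
∈-states (a , b , c) =
  ∈-cartesianProduct⁺ (∈-bools a) (∈-cartesianProduct⁺ (∈-bools b) (∈-bools c))
  where
  ∈-bools : ∀ b → b ∈ true ∷ false ∷ []
  ∈-bools true  = here refl
  ∈-bools false = there (here refl)

-- Expectation scaled by `8 ^ n`, so that probabilities stay in ℕ.
total : ∀ n → (Vec State n → ℕ) → ℕ
total zero    f = f []
total (suc n) f = total n λ ω → ∑ states λ s → f (s ∷ ω)

total-mono : ∀ n {f g} → (∀ ω → f ω ≤ g ω) → total n f ≤ total n g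
total-mono zero    f≤g = f≤g []
total-mono (suc n) f≤g = total-mono n λ ω → ∑-mono states λ s → f≤g (s ∷ ω)

total-cong : ∀ n {f g} → (∀ ω → f ω ≡ g ω) → total n f ≡ total n g
total-cong n f≡g = ≤-antisym (total-mono n (≤-reflexive ∘ f≡g))
                             (total-mono n (≤-reflexive ∘ sym ∘ f≡g))

total-+ : ∀ n f g → total n (λ ω → f ω + g ω) ≡ total n f + total n g
total-+ zero    f g = refl
total-+ (suc n) f g =
  trans (total-cong n λ ω → ∑-+ states (f ∘ (_∷ ω)) (g ∘ (_∷ ω))) (total-+ n _ _)

total-*ˡ : ∀ n c f → total n (λ ω → c * f ω) ≡ c * total n f
total-*ˡ zero    c f = refl
total-*ˡ (suc n) c f =
  trans (total-cong n λ ω → ∑-*ˡ c states (f ∘ (_∷ ω))) (total-*ˡ n c _)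

total-zero : ∀ n {f} → (∀ ω → f ω ≡ 0) → total n f ≡ 0
total-zero n f≡0 = trans (total-cong n f≡0) (total-*ˡ n 0 (const 0))

total-one : ∀ n → total n (const 1) ≡ 8 ^ n
total-one zero    = refl
total-one (suc n) = trans (total-*ˡ n 8 (const 1)) (cong (8 *_) (total-one n))

total-∑ : ∀ n (xs : List A) (f : A → Vec State n → ℕ) →
          total n (λ ω → ∑ xs λ x → f x ω) ≡ ∑ xs λ x → total n (f x)
total-∑ n []       f = total-zero n λ _ → refl
total-∑ n (x ∷ xs) f =
  trans (total-+ n (f x) _) (cong (total n (f x) +_) (total-∑ n xs f))

-- Once the states of the elements before x (in the sense of ≺) are known, some
-- state of x falsifies P.  Summing over the elements in the order ≺, each such x
-- costs a factor 7/8.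
Blocks : (Fin n → Fin n → Set) → (Vec State n → Bool) → Fin n → Set
Blocks _≺_ P x = ∀ ω → Σ[ s ∈ State ] (∀ ω′ →
  (∀ y → y ≺ x → lookup ω′ y ≡ lookup ω y) → lookup ω′ x ≡ s → P ω′ ≡ false)

-- Slice by the state of element 0, the first to be exposed. Each slice inherits the blocking by
-- later elements, and if 0 lies in `X` one whole slice vanishes.
total-blocked-< : ∀ n (X : Subset n) (P : Vec State n → Bool) →
                  (∀ {x} → x ∈ˢ X → Blocks _<ᶠ_ P x) →
                  total n (𝟙 ∘ P) * 8 ^ ∣ X ∣ ≤ 7 ^ ∣ X ∣ * 8 ^ n
total-blocked-< zero    []      P blocks = *-monoˡ-≤ 1 (𝟙≤1 (P []))
total-blocked-< (suc n) (b ∷ X) P blocks = by b blocks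
  where
  open ≤-Reasoning
  k = ∣ X ∣
  B = 7 ^ k * 8 ^ n
  slice : State → ℕ
  slice s = total n λ ω → 𝟙 (P (s ∷ ω))

  module _ {b} (blocks : ∀ {x} → x ∈ˢ b ∷ X → Blocks _<ᶠ_ P x) where
    slice≤ : ∀ s → slice s * 8 ^ k ≤ B
    slice≤ s = total-blocked-< n X (P ∘ (s ∷_)) λ x∈X ω →
      let s′ , blocked = blocks (there x∈X) (s ∷ ω) in
      s′ , λ ω′ agree → blocked (s ∷ ω′)
        λ { zero _ → refl ; (suc y) (s≤s y<x) → agree y y<x }

  split = total-∑ n states λ s ω → 𝟙 (P (s ∷ ω))

  by : ∀ b → (∀ {x} → x ∈ˢ b ∷ X → Blocks _<ᶠ_ P x) →
       total (suc n) (𝟙 ∘ P) * 8 ^ ∣ b ∷ X ∣ ≤ 7 ^ ∣ b ∷ X ∣ * 8 ^ suc n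
  by outside blocks = begin
    total (suc n) (𝟙 ∘ P) * 8 ^ k  ≡⟨ cong (_* 8 ^ k) split ⟩
    ∑ states slice * 8 ^ k         ≤⟨ ∑-≤ states slice (slice≤ blocks) ⟩
    8 * B                          ≡⟨ lemma (7 ^ k) (8 ^ n) ⟩
    7 ^ k * 8 ^ suc n              ∎
    where
    lemma : ∀ u v → 8 * (u * v) ≡ u * (8 * v)
    lemma = solve-∀
  -- Nothing precedes element 0, so its blocking state works for every ω and an arbitrary vector may
  -- be supplied.
  by inside blocks with s , blocked ← blocks here (replicate _ (true , true , true)) =
    begin
    total (suc n) (𝟙 ∘ P) * 8 ^ suc k  ≡⟨ cong (_* 8 ^ suc k) split ⟩
    ∑ states slice * (8 * 8 ^ k)       ≡⟨ lemma₁ (∑ states slice) (8 ^ k) ⟩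
    8 * (∑ states slice * 8 ^ k)       ≤⟨ *-monoʳ-≤ 8 (+-cancelˡ-≤ B _ _
                                            (∑-≤-vanishing slice (∈-states s) vanishes
                                              (slice≤ blocks))) ⟩
    8 * (7 * B)                        ≡⟨ lemma₂ (7 ^ k) (8 ^ n) ⟩
    7 ^ suc k * 8 ^ suc n              ∎
    where
    vanishes : slice s ≡ 0
    vanishes = total-zero n λ ω → cong 𝟙 (blocked (s ∷ ω) (λ _ ()) refl)
    lemma₁ : ∀ u v → u * (8 * v) ≡ 8 * (u * v)
    lemma₁ = solve-∀
    lemma₂ : ∀ u v → 8 * (7 * (u * v)) ≡ 7 * u * (8 * v)
    lemma₂ = solve-∀

-- Element 0 is now exposed last and its blocking state depends on the others, so no slice need
-- vanish. Instead `Q` projects its state away: `Q` is blocked by the rest of `X`, and each ω with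
-- `Q ω` extends in at most 8 ways, or 7 if 0 lies in `X`.
total-blocked-> : ∀ n (X : Subset n) (P : Vec State n → Bool) →
                  (∀ {x} → x ∈ˢ X → Blocks _>ᶠ_ P x) →
                  total n (𝟙 ∘ P) * 8 ^ ∣ X ∣ ≤ 7 ^ ∣ X ∣ * 8 ^ n
total-blocked-> zero    []      P blocks = *-monoˡ-≤ 1 (𝟙≤1 (P []))
total-blocked-> (suc n) (b ∷ X) P blocks = by b blocks
  where
  open ≤-Reasoning
  k = ∣ X ∣
  Q : Vec State n → Bool
  Q ω = any (λ s → P (s ∷ ω)) states

  𝟙P≤𝟙Q : ∀ ω s → 𝟙 (P (s ∷ ω)) * 1 ≤ 𝟙 (Q ω)
  𝟙P≤𝟙Q ω s rewrite *-identityʳ (𝟙 (P (s ∷ ω))) =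
    𝟙-mono (any-∈ (λ s → P (s ∷ ω)) (∈-states s))

  module _ {b} (blocks : ∀ {x} → x ∈ˢ b ∷ X → Blocks _>ᶠ_ P x) where
    Q≤ : total n (𝟙 ∘ Q) * 8 ^ k ≤ 7 ^ k * 8 ^ n
    Q≤ = total-blocked-> n X Q λ x∈X ω →
      let s , blocked = blocks (there x∈X) ((true , true , true) ∷ ω) in
      s , λ ω′ agree x≡s → any-none (λ s → P (s ∷ ω′)) states λ {s′} _ →
        blocked (s′ ∷ ω′) (λ { (suc y) (s≤s y>x) → agree y y>x }) x≡s

    fibres : ∀ c → (∀ ω → ∑ states (λ s → 𝟙 (P (s ∷ ω))) ≤ c * 𝟙 (Q ω)) →
             total (suc n) (𝟙 ∘ P) * 8 ^ k ≤ c * (7 ^ k * 8 ^ n)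
    fibres c ∑≤ = begin
      total (suc n) (𝟙 ∘ P) * 8 ^ k          ≤⟨ *-monoˡ-≤ (8 ^ k) (total-mono n ∑≤) ⟩
      total n (λ ω → c * 𝟙 (Q ω)) * 8 ^ k    ≡⟨ cong (_* 8 ^ k) (total-*ˡ n c (𝟙 ∘ Q)) ⟩
      c * total n (𝟙 ∘ Q) * 8 ^ k            ≡⟨ *-assoc c _ _ ⟩
      c * (total n (𝟙 ∘ Q) * 8 ^ k)          ≤⟨ *-monoʳ-≤ c Q≤ ⟩
      c * (7 ^ k * 8 ^ n)                    ∎

  by : ∀ b → (∀ {x} → x ∈ˢ b ∷ X → Blocks _>ᶠ_ P x) →
       total (suc n) (𝟙 ∘ P) * 8 ^ ∣ b ∷ X ∣ ≤ 7 ^ ∣ b ∷ X ∣ * 8 ^ suc n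
  by outside blocks = begin
    total (suc n) (𝟙 ∘ P) * 8 ^ k  ≤⟨ fibres blocks 8 (λ ω → ≤-trans
                                       (≤-reflexive (sym (*-identityʳ _)))
                                       (∑-≤ states (λ s → 𝟙 (P (s ∷ ω))) (𝟙P≤𝟙Q ω))) ⟩
    8 * (7 ^ k * 8 ^ n)            ≡⟨ lemma (7 ^ k) (8 ^ n) ⟩
    7 ^ k * 8 ^ suc n              ∎
    where
    lemma : ∀ u v → 8 * (u * v) ≡ u * (8 * v)
    lemma = solve-∀
  by inside blocks = begin
    total (suc n) (𝟙 ∘ P) * 8 ^ suc k    ≡⟨ lemma₁ (total (suc n) (𝟙 ∘ P)) (8 ^ k) ⟩
    8 * (total (suc n) (𝟙 ∘ P) * 8 ^ k)  ≤⟨ *-monoʳ-≤ 8 (fibres blocks 7 ∑≤) ⟩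
    8 * (7 * (7 ^ k * 8 ^ n))            ≡⟨ lemma₂ (7 ^ k) (8 ^ n) ⟩
    7 ^ suc k * 8 ^ suc n                ∎
    where
    ∑≤ : ∀ ω → ∑ states (λ s → 𝟙 (P (s ∷ ω))) ≤ 7 * 𝟙 (Q ω)
    ∑≤ ω with s , blocked ← blocks here ((true , true , true) ∷ ω) =
      +-cancelˡ-≤ (𝟙 (Q ω)) _ _ (≤-trans
        (≤-reflexive (cong (𝟙 (Q ω) +_) (sym (*-identityʳ _))))
        (∑-≤-vanishing (λ s → 𝟙 (P (s ∷ ω))) (∈-states s)
          (cong 𝟙 (blocked (s ∷ ω) (λ { (suc y) _ → refl }) refl)) (𝟙P≤𝟙Q ω)))
    lemma₁ : ∀ u v → u * (8 * v) ≡ 8 * (u * v)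
    lemma₁ = solve-∀
    lemma₂ : ∀ u v → 8 * (7 * (u * v)) ≡ 7 * u * (8 * v)
    lemma₂ = solve-∀

keptSet : Vec State n → Subset n
keptSet = mapᵛ kept

-- Exponential-moment bound: the indicator of `k < t` is at most 2^(t - k), and one element
-- contributes 4 · 1/2 + 4 = 6 to the total of 2^(-k). The double induction avoids fractions.
total-few-kept : ∀ n t → total n (λ ω → 𝟙 (∣ keptSet ω ∣ <ᵇ t)) ≤ 6 ^ n * 2 ^ t
total-few-kept n       zero    = ≤-trans (≤-reflexive (total-zero n λ _ → refl)) z≤n
total-few-kept zero    (suc t) = ≤-trans (^-monoʳ-≤ 2 {0} {suc t} z≤n) (m≤m+n _ 0)
total-few-kept (suc n) (suc t) = begin
  total n (λ ω → ∑ states λ s → 𝟙 (∣ keptSet (s ∷ ω) ∣ <ᵇ suc t))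
    ≡⟨ total-cong n (λ ω → lemma₁ (f t ω) (f (suc t) ω)) ⟩
  total n (λ ω → 4 * f t ω + 4 * f (suc t) ω)
    ≡⟨ total-+ n _ _ ⟩
  total n (λ ω → 4 * f t ω) + total n (λ ω → 4 * f (suc t) ω)
    ≡⟨ cong₂ _+_ (total-*ˡ n 4 _) (total-*ˡ n 4 _) ⟩
  4 * total n (f t) + 4 * total n (f (suc t))
    ≤⟨ +-mono-≤ (*-monoʳ-≤ 4 (total-few-kept n t))
                (*-monoʳ-≤ 4 (total-few-kept n (suc t))) ⟩
  4 * (6 ^ n * 2 ^ t) + 4 * (6 ^ n * 2 ^ suc t)
    ≡⟨ lemma₂ (6 ^ n) (2 ^ t) ⟩
  6 ^ suc n * 2 ^ suc t ∎
  where
  open ≤-Reasoning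
  f : ℕ → Vec State n → ℕ
  f t ω = 𝟙 (∣ keptSet ω ∣ <ᵇ t)
  lemma₁ : ∀ u v → u + (u + (u + (u + (v + (v + (v + (v + 0))))))) ≡ 4 * u + 4 * v
  lemma₁ = solve-∀
  lemma₂ : ∀ u v → 4 * (u * v) + 4 * (u * (2 * v)) ≡ 6 * u * (2 * v)
  lemma₂ = solve-∀

-- Touched elements, with preliminaries on xor and subsets

does-true⇒ : ∀ {P : Set} (P? : Dec P) → does P? ≡ true → P
does-true⇒ P? eq = invert (subst (Reflects _) eq (proof P?))

xor-cancelʳ : ∀ b c → (b xor c) xor c ≡ b
xor-cancelʳ b c = trans (xor-assoc b c c) (trans (cong (b xor_) (xor-same c)) (xor-identityʳ b))

xor-cancelˡ : ∀ b c → c xor (c xor b) ≡ b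
xor-cancelˡ b c = trans (sym (xor-assoc c c b)) (cong (_xor b) (xor-same c))

∣p∪q∣≤∣p∣+∣q∣ : ∀ (p q : Subset n) → ∣ p ∪ q ∣ ≤ ∣ p ∣ + ∣ q ∣
∣p∪q∣≤∣p∣+∣q∣ []            []            = z≤n
∣p∪q∣≤∣p∣+∣q∣ (inside  ∷ p) (y       ∷ q) = s≤s (≤-trans (∣p∪q∣≤∣p∣+∣q∣ p q)
                                                 (+-monoʳ-≤ ∣ p ∣ (∣p∣≤∣x∷p∣ y q)))
∣p∪q∣≤∣p∣+∣q∣ (outside ∷ p) (inside  ∷ q) = ≤-trans (s≤s (∣p∪q∣≤∣p∣+∣q∣ p q))
                                              (≤-reflexive (sym (+-suc ∣ p ∣ ∣ q ∣)))
∣p∪q∣≤∣p∣+∣q∣ (outside ∷ p) (outside ∷ q) = ∣p∪q∣≤∣p∣+∣q∣ p q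

∣q∣<∣p∣⇒∃∈∖ : ∀ {p q : Subset n} → ∣ q ∣ < ∣ p ∣ → ∃ λ x → x ∈ˢ p × x ∉ˢ q
∣q∣<∣p∣⇒∃∈∖ {p = p} {q} q<p
  with x , x∉ ← ¬∀⇒∃¬ _ (λ x → x ∈ˢ p → x ∈ˢ q) (λ x → x ∈? p →-dec x ∈? q)
                  (λ p⊆q → <⇒≱ q<p (p⊆q⇒∣p∣≤∣q∣ (p⊆q _)))
  = x , decidable-stable (x ∈? p) (λ x∉p → x∉ λ x∈p → contradiction x∈p x∉p)
      , λ x∈q → x∉ (const x∈q)

-- A variable S i j touches j only: a literal on it says nothing about i beyond
-- whether i is the witness chosen for j.
high low : Var n → Fin n
high (R i)   = i
high (L i j) = if toℕ i ≤ᵇ toℕ j then j else i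
high (S i j) = j
low (R i)   = i
low (L i j) = if toℕ i ≤ᵇ toℕ j then i else j
low (S i j) = j

Touches : Var n → Fin n → Set
Touches v x = x ≡ high v ⊎ x ≡ low v

touches-L⁺ : ∀ (i j : Fin n) → Touches (L i j) i × Touches (L i j) j
touches-L⁺ i j with toℕ i ≤ᵇ toℕ j
... | true  = inj₂ refl , inj₁ refl
... | false = inj₁ refl , inj₂ refl

touches-L⁻ : ∀ {i j x : Fin n} → Touches (L i j) x → x ≡ i ⊎ x ≡ j
touches-L⁻ {i = i} {j} t with toℕ i ≤ᵇ toℕ j | t
... | true  | inj₁ x≡j = inj₂ x≡j
... | true  | inj₂ x≡i = inj₁ x≡i
... | false | inj₁ x≡i = inj₁ x≡i
... | false | inj₂ x≡j = inj₂ x≡j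

low≤high : ∀ (v : Var n) → toℕ (low v) ≤ toℕ (high v)
low≤high (R i)   = ≤-refl
low≤high (S i j) = ≤-refl
low≤high (L i j) with toℕ i ≤ᵇ toℕ j in eq
... | true  = ≤ᵇ⇒≤ _ _ (subst T (sym eq) _)
... | false = ≰⇒≥ λ i≤j → subst T eq (≤⇒≤ᵇ i≤j)

low<high : ∀ (v : Var n) → low v ≢ high v → low v <ᶠ high v
low<high v low≢high = ≤∧≢⇒< (low≤high v) (low≢high ∘ toℕ-injective)

var : Literal (Var n) → Var n
var (pos v) = v
var (neg v) = v

isZero : Fin n → Bool
isZero zero    = true
isZero (suc _) = false

-- Supports of clauses and the random restriction

module _ (top : Fin n) where

  -- Leaves out `top`: its state is overridden, so drawing it cannot help to satisfy a literal.
  support : (Var n → Fin n) → Clause (Var n) → Subset n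
  support end C =
    tabulate λ x → does (¬? (x ≟ top) ×-dec any? (λ ℓ → end (var ℓ) ≟ x) C)

  ∈-support⁻ : ∀ {end C x} → x ∈ˢ support end C →
               x ≢ top × ∃ λ ℓ → ℓ ∈ C × end (var ℓ) ≡ x
  ∈-support⁻ {end} {C} {x} x∈ = proj₁ both , find (proj₂ both)
    where
    both : x ≢ top × Any (λ ℓ → end (var ℓ) ≡ x) C
    both = does-true⇒ (¬? (x ≟ top) ×-dec any? (λ ℓ → end (var ℓ) ≟ x) C)
                      (trans (sym (lookup∘tabulate _ x)) ([]=⇒lookup x∈))

  ∈-support⁺ : ∀ end {C x ℓ} → x ≢ top → ℓ ∈ C → x ≡ end (var ℓ) → x ∈ˢ support end C
  ∈-support⁺ end {C} {x} x≢top ℓ∈C x≡end = lookup⇒[]= x _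
    (trans (lookup∘tabulate _ x) (dec-true (¬? (x ≟ top) ×-dec any? (λ ℓ → end (var ℓ) ≟ x) C)
      (x≢top , lose ℓ∈C (sym x≡end))))

  -- The elements to avoid are `top`, the two ends of `v` and the two supports, at most 3 + 2t
  -- together.
  fresh : ∀ {A : Subset n} {t} {C : Clause (Var n)} (v : Var n) →
          ∣ support high C ∣ ≤ t → ∣ support low C ∣ ≤ t → 3 + (t + t) < ∣ A ∣ →
          ∃ λ x → x ∈ˢ A × x ≢ top × ¬ Touches v x × (∀ {ℓ} → ℓ ∈ C → ¬ Touches (var ℓ) x)
  fresh {A} {t} {C} v high≤ low≤ large =
    let x , x∈A , x∉ = ∣q∣<∣p∣⇒∃∈∖ {p = A} (≤-<-trans ∣B∣≤ large)
    in  x , x∈A , x≢top x∉ , ¬v x∉ , ¬C x∉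
    where
    X Y B : Subset n
    X = support high C
    Y = support low C
    B = ⁅ top ⁆ ∪ (⁅ high v ⁆ ∪ (⁅ low v ⁆ ∪ (X ∪ Y)))
    ∣⁅x⁆∪q∣≤ : ∀ x {q : Subset n} {k} → ∣ q ∣ ≤ k → ∣ ⁅ x ⁆ ∪ q ∣ ≤ suc k
    ∣⁅x⁆∪q∣≤ x {q} q≤k = ≤-trans (∣p∪q∣≤∣p∣+∣q∣ ⁅ x ⁆ q)
      (+-mono-≤ (≤-reflexive (∣⁅x⁆∣≡1 x)) q≤k)
    ∣B∣≤ : ∣ B ∣ ≤ 3 + (t + t)
    ∣B∣≤ = ∣⁅x⁆∪q∣≤ top (∣⁅x⁆∪q∣≤ (high v) (∣⁅x⁆∪q∣≤ (low v)
      (≤-trans (∣p∪q∣≤∣p∣+∣q∣ X Y) (+-mono-≤ high≤ low≤))))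
    module _ {x : Fin n} (x∉ : x ∉ˢ B) where
      x≢top : x ≢ top
      x≢top refl = x∉ (x∈p∪q⁺ (inj₁ (x∈⁅x⁆ top)))
      ¬v : ¬ Touches v x
      ¬v (inj₁ refl) = x∉ (x∈p∪q⁺ (inj₂ (x∈p∪q⁺ (inj₁ (x∈⁅x⁆ _)))))
      ¬v (inj₂ refl) = x∉ (x∈p∪q⁺ (inj₂ (x∈p∪q⁺ (inj₂ (x∈p∪q⁺ (inj₁ (x∈⁅x⁆ _)))))))
      x∉X∪Y : ¬ (x ∈ˢ X ⊎ x ∈ˢ Y)
      x∉X∪Y x∈ = x∉ (x∈p∪q⁺ (inj₂ (x∈p∪q⁺ (inj₂ (x∈p∪q⁺ (inj₂ (x∈p∪q⁺ x∈)))))))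
      ¬C : ∀ {ℓ} → ℓ ∈ C → ¬ Touches (var ℓ) x
      ¬C ℓ∈C (inj₁ x≡) = x∉X∪Y (inj₁ (∈-support⁺ high x≢top ℓ∈C x≡))
      ¬C ℓ∈C (inj₂ x≡) = x∉X∪Y (inj₂ (∈-support⁺ low x≢top ℓ∈C x≡))

  -- R top is an axiom, so the state drawn for top is overridden.
  status : Vec State n → Fin n → State
  status ω i = if does (i ≟ top) then (true , false , false) else lookup ω i

  restrict : Vec State n → Var n → Maybe Bool
  restrict ω (R i)   = just (kept (status ω i))
  -- By the xor, either end, once dropped, can set the value whatever the state of the other.
  restrict ω (L i j) = if kept (status ω i) ∧ kept (status ω j) then nothing
                       else just (row (status ω i) xor column (status ω j))
  restrict ω (S i j) = if kept (status ω j)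
                       -- A kept j with a dropped witness i would falsify `relativized i j`.
                       then (if kept (status ω i) then nothing else just false)
                       -- takes both values as i varies, hence satisfies `witness j`
                       else just (row (status ω j) xor isZero i)

  status-≢ : ∀ {ω i} → i ≢ top → status ω i ≡ lookup ω i
  status-≢ {i = i} i≢top rewrite dec-false (i ≟ top) i≢top = refl

  status-cong : ∀ {ω ω′ i} → lookup ω′ i ≡ lookup ω i → status ω′ i ≡ status ω i
  status-cong {i = i} eq = cong (if does (i ≟ top) then _ else_) eq

  -- For `R` the value is a component of the state. Otherwise x is dropped and one of its bits is
  -- chosen to cancel the fixed part of the xor.
  steer : ∀ v {x} → Touches v x → x ≢ top → ∀ b ω → Σ[ s ∈ State ] (∀ ω′ →
          (∀ y → Touches v y → y ≢ x → lookup ω′ y ≡ lookup ω y) →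
          lookup ω′ x ≡ s → restrict ω′ v ≡ just b)
  steer (R i) t x≢top b ω = (b , false , false) , λ ω′ _ x≡s →
    cong (just ∘ kept) (trans (cong (status ω′) (sym (only t)))
                              (trans (status-≢ {ω′} x≢top) x≡s))
    where
    only : ∀ {x} → Touches (R i) x → x ≡ i
    only (inj₁ x≡i) = x≡i
    only (inj₂ x≡i) = x≡i
  steer (S i j) {x} t x≢top b ω = (false , b xor isZero i , false) , λ ω′ _ → forced ω′ (only t)
    where
    only : ∀ {x} → Touches (S i j) x → x ≡ j
    only (inj₁ x≡j) = x≡j
    only (inj₂ x≡j) = x≡j
    forced : ∀ ω′ → x ≡ j → lookup ω′ x ≡ (false , b xor isZero i , false) →
             restrict ω′ (S i j) ≡ just b
    forced ω′ refl x≡s rewrite trans (status-≢ {ω′} x≢top) x≡s =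
      cong just (xor-cancelʳ b (isZero i))
  steer (L i j) {x} t x≢top b ω with i ≟ j | touches-L⁻ {i = i} {j} t
  ... | yes refl | t′ = (false , b , false) , λ ω′ _ → forced ω′ (only t′)
    where
    only : x ≡ i ⊎ x ≡ i → x ≡ i
    only (inj₁ x≡i) = x≡i
    only (inj₂ x≡i) = x≡i
    forced : ∀ ω′ → x ≡ i → lookup ω′ x ≡ (false , b , false) →
             restrict ω′ (L i i) ≡ just b
    forced ω′ refl x≡s rewrite trans (status-≢ {ω′} x≢top) x≡s =
      cong just (xor-identityʳ b)
  ... | no i≢j | inj₁ refl = (false , b xor column (status ω j) , false) , forced
    where
    forced : ∀ ω′ → (∀ y → Touches (L i j) y → y ≢ i → lookup ω′ y ≡ lookup ω y) →
             lookup ω′ i ≡ (false , b xor column (status ω j) , false) →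
             restrict ω′ (L i j) ≡ just b
    forced ω′ agree x≡s
      rewrite trans (status-≢ {ω′} x≢top) x≡s
            | status-cong {ω} {ω′} (agree j (proj₂ (touches-L⁺ i j)) (i≢j ∘ sym))
      = cong just (xor-cancelʳ b (column (status ω j)))
  ... | no i≢j | inj₂ refl = (false , false , row (status ω i) xor b) , forced
    where
    forced : ∀ ω′ → (∀ y → Touches (L i j) y → y ≢ j → lookup ω′ y ≡ lookup ω y) →
             lookup ω′ j ≡ (false , false , row (status ω i) xor b) →
             restrict ω′ (L i j) ≡ just b
    forced ω′ agree x≡s
      rewrite trans (status-≢ {ω′} x≢top) x≡s
            | status-cong {ω} {ω′} (agree i (proj₁ (touches-L⁺ i j)) i≢j)
            | ∧-zeroʳ (kept (status ω i))
      = cong just (xor-cancelˡ b (row (status ω i)))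

  -- The defaults differ so that an undetermined variable satisfies neither of its literals.
  satisfies : Vec State n → Literal (Var n) → Bool
  satisfies ω (pos v) = fromMaybe false (restrict ω v)
  satisfies ω (neg v) = not (fromMaybe true (restrict ω v))

  steer-literal : ∀ ℓ {x} → Touches (var ℓ) x → x ≢ top → ∀ ω → Σ[ s ∈ State ] (∀ ω′ →
                  (∀ y → Touches (var ℓ) y → y ≢ x → lookup ω′ y ≡ lookup ω y) →
                  lookup ω′ x ≡ s → satisfies ω′ ℓ ≡ true)
  steer-literal (pos v) t x≢top ω with s , forced ← steer v t x≢top true ω =
    s , λ ω′ agree x≡s → cong (fromMaybe false) (forced ω′ agree x≡s)
  steer-literal (neg v) t x≢top ω with s , forced ← steer v t x≢top false ω =
    s , λ ω′ agree x≡s → cong (not ∘ fromMaybe true) (forced ω′ agree x≡s)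

  unsatisfied : Clause (Var n) → Vec State n → Bool
  unsatisfied C ω = not (any (satisfies ω) C)

  -- Such an x is the chosen end of some literal of `C`. Any other element touched by that literal
  -- comes earlier in `_≺_`, so its state is known and x can steer the literal to true.
  blocks-support : ∀ (end : Var n → Fin n) {_≺_} → (∀ v → Touches v (end v)) →
                   (∀ v {y} → Touches v y → y ≢ end v → y ≺ end v) →
                   ∀ {C x} → x ∈ˢ support end C → Blocks _≺_ (unsatisfied C) x
  blocks-support end touches ≺end {C} x∈ ω
    with x≢top , ℓ , ℓ∈C , refl ← ∈-support⁻ {end} {C} x∈
    with s , forced ← steer-literal ℓ (touches (var ℓ)) x≢top ω
    = s , λ ω′ agree x≡s → cong not (any-∈ (satisfies ω′) ℓ∈C
        (forced ω′ (λ y t y≢x → agree y (≺end (var ℓ) t y≢x)) x≡s))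

  blocks-high : ∀ {C x} → x ∈ˢ support high C → Blocks _<ᶠ_ (unsatisfied C) x
  blocks-high {C} = blocks-support high (λ _ → inj₁ refl) below {C}
    where
    below : ∀ v {y} → Touches v y → y ≢ high v → y <ᶠ high v
    below v (inj₁ y≡)   y≢ = contradiction y≡ y≢
    below v (inj₂ refl) y≢ = low<high v y≢

  blocks-low : ∀ {C x} → x ∈ˢ support low C → Blocks _>ᶠ_ (unsatisfied C) x
  blocks-low {C} = blocks-support low (λ _ → inj₂ refl) above {C}
    where
    above : ∀ v {y} → Touches v y → y ≢ low v → y >ᶠ low v
    above v (inj₁ refl) y≢ = low<high v (y≢ ∘ sym)
    above v (inj₂ y≡)   y≢ = contradiction y≡ y≢

-- Total assignments extending a restriction

true≢false : ∀ {b} → b ≡ true → b ≡ false → ⊥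
true≢false refl ()

<⇒<ᵇ≡true : ∀ {a b} → a < b → (a <ᵇ b) ≡ true
<⇒<ᵇ≡true a<b = to T-≡ (<⇒<ᵇ a<b)

<ᵇ≡true⇒< : ∀ {a b} → (a <ᵇ b) ≡ true → a < b
<ᵇ≡true⇒< eq = <ᵇ⇒< _ _ (from T-≡ eq)

<ᵇ≡false⇒≥ : ∀ {a b} → (a <ᵇ b) ≡ false → b ≤ a
<ᵇ≡false⇒≥ eq = ≮⇒≥ λ a<b → true≢false (<⇒<ᵇ≡true a<b) eq

value : (Var n → Bool) → Literal (Var n) → Bool
value α (pos v) = α v
value α (neg v) = not (α v)

value-cong : ∀ {α β : Var n → Bool} ℓ → α (var ℓ) ≡ β (var ℓ) → value α ℓ ≡ value β ℓ
value-cong (pos v) = λ eq → eq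
value-cong (neg v) = cong not

Falsified : (Var n → Bool) → Clause (Var n) → Set
Falsified α C = ∀ {ℓ} → ℓ ∈ C → value α ℓ ≡ false

Untouched : Fin n → Clause (Var n) → Set
Untouched x C = ∀ {ℓ} → ℓ ∈ C → ¬ Touches (var ℓ) x

module _ (top : Fin n) (ω : Vec State n) where

  Kept : Fin n → Set
  Kept i = kept (status top ω i) ≡ true

  -- A larger rank means further down, that is, smaller in the order. Ranks may repeat, since
  -- comparing them is still irreflexive and transitive; `bound` is a rank ready for a new bottom.
  record Descent : Set where
    field
      rank        : Fin n → ℕ
      bound       : ℕ
      rank<bound  : ∀ i → rank i < bound
      witnessOf   : Fin n → Fin n
      bottom      : Fin n
      bottom-kept : Kept bottom
      descends    : ∀ {j} → Kept j → j ≢ bottom →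
                    Kept (witnessOf j) × rank j < rank (witnessOf j)

  open Descent

  guess : Descent → Var n → Bool
  guess d (R i)   = false
  guess d (L i j) = rank d j <ᵇ rank d i
  guess d (S i j) = does (witnessOf d j ≟ i)

  extend : Descent → Var n → Bool
  extend d v = fromMaybe (guess d v) (restrict top ω v)

  extend-L : ∀ d i j → Kept i → Kept j → extend d (L i j) ≡ (rank d j <ᵇ rank d i)
  extend-L d i j ki kj rewrite ki | kj = refl

  extend-S : ∀ d i j → Kept i → Kept j → extend d (S i j) ≡ does (witnessOf d j ≟ i)
  extend-S d i j ki kj rewrite ki | kj = refl

  -- `extend` only fills the gaps of `restrict`, so a literal already satisfied stays true.
  falsified⇒unsatisfied : ∀ d C → Falsified (extend d) C → unsatisfied top C ω ≡ true
  falsified⇒unsatisfied d C F =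
    cong not (any-none (satisfies top ω) C λ {ℓ} ℓ∈C → undetermined ℓ (F ℓ∈C))
    where
    undetermined : ∀ ℓ → value (extend d) ℓ ≡ false → satisfies top ω ℓ ≡ false
    undetermined (pos v) eq with restrict top ω v
    ... | just _  = eq
    ... | nothing = refl
    undetermined (neg v) eq with restrict top ω v
    ... | just _  = eq
    ... | nothing = refl

  -- `top` can serve as the first bottom because `status` keeps it for every ω.
  initial : Descent
  initial = record
    { rank        = updateAt (const 0) top (const 1)
    ; bound       = 2
    ; rank<bound  = initial-rank<2
    ; witnessOf   = const top
    ; bottom      = top
    ; bottom-kept = top-kept
    ; descends    = λ {j} _ j≢top → top-kept , subst₂ _<_
        (sym (updateAt-minimal j top (const 0) j≢top))
        (sym (updateAt-updates top (const 0))) ≤-refl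
    }
    where
    top-kept : Kept top
    top-kept rewrite dec-true (top ≟ top) refl = refl
    initial-rank<2 : ∀ i → updateAt (const 0) top (const 1) i < 2
    initial-rank<2 i with i ≟ top
    ... | yes refl = subst (_< 2) (sym (updateAt-updates top (const 0))) ≤-refl
    ... | no i≢top = subst (_< 2) (sym (updateAt-minimal i top (const 0) i≢top)) (s≤s z≤n)

  module _ (d : Descent) {x : Fin n} (x-kept : Kept x) where

    private
      rank′ : Fin n → ℕ
      rank′ = updateAt (rank d) x (const (bound d))
      witnessOf′ : Fin n → Fin n
      witnessOf′ = updateAt (witnessOf d) (bottom d) (const x)

      rank′-x : rank′ x ≡ bound d
      rank′-x = updateAt-updates x (rank d)

      rank′-≢ : ∀ {i} → i ≢ x → rank′ i ≡ rank d i
      rank′-≢ {i} i≢x = updateAt-minimal i x (rank d) i≢x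

      rank′-≥ : ∀ i → rank d i ≤ rank′ i
      rank′-≥ i with i ≟ x
      ... | yes refl = ≤-trans (<⇒≤ (rank<bound d x)) (≤-reflexive (sym rank′-x))
      ... | no i≢x   = ≤-reflexive (sym (rank′-≢ i≢x))

    -- The rank `bound d` puts x strictly below all other elements, so x is a legitimate witness for
    -- the old bottom.
    move : Descent
    move = record
      { rank        = rank′
      ; bound       = suc (bound d)
      ; rank<bound  = rank′<
      ; witnessOf   = witnessOf′
      ; bottom      = x
      ; bottom-kept = x-kept
      ; descends    = descends′
      }
      where
      rank′< : ∀ i → rank′ i < suc (bound d)
      rank′< i with i ≟ x
      ... | yes refl = s≤s (≤-reflexive rank′-x)
      ... | no i≢x   = s≤s (≤-trans (≤-reflexive (rank′-≢ i≢x)) (<⇒≤ (rank<bound d i)))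
      descends′ : ∀ {j} → Kept j → j ≢ x → Kept (witnessOf′ j) × rank′ j < rank′ (witnessOf′ j)
      descends′ {j} kj j≢x with j ≟ bottom d
      ... | yes refl = subst (λ y → Kept y × rank′ j < rank′ y)
        (sym (updateAt-updates j (witnessOf d)))
        (x-kept , subst₂ _<_ (sym (rank′-≢ j≢x)) (sym rank′-x) (rank<bound d j))
      -- The witness of j may be x itself, whose rank has only grown.
      ... | no j≢b with kw , j<w ← descends d kj j≢b =
        subst (λ y → Kept y × rank′ j < rank′ y)
        (sym (updateAt-minimal j (bottom d) (witnessOf d) j≢b))
        (kw , ≤-trans (subst (_< rank d (witnessOf d j)) (sym (rank′-≢ j≢x)) j<w) (rank′-≥ _))

    -- Only the rank of x and the witness of the old bottom change: the former enters `L` literals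
    -- at x, the latter `S i j` with j the old bottom.
    extend-move : ∀ v → ¬ Touches v (bottom d) → ¬ Touches v x →
                  extend move v ≡ extend d v
    extend-move v ¬b ¬x = cong (λ b → fromMaybe b (restrict top ω v)) (guess-move v ¬b ¬x)
      where
      guess-move : ∀ v → ¬ Touches v (bottom d) → ¬ Touches v x → guess move v ≡ guess d v
      guess-move (R i)   ¬b ¬x = refl
      guess-move (L i j) ¬b ¬x = cong₂ _<ᵇ_
        (rank′-≢ λ { refl → ¬x (proj₂ (touches-L⁺ i j)) })
        (rank′-≢ λ { refl → ¬x (proj₁ (touches-L⁺ i j)) })
      guess-move (S i j) ¬b ¬x = cong (λ y → does (y ≟ i))
        (updateAt-minimal j (bottom d) (witnessOf d) λ { refl → ¬b (inj₁ refl) })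

    falsified-move : ∀ {C} → Untouched (bottom d) C → Untouched x C →
                     Falsified (extend d) C → Falsified (extend move) C
    falsified-move ¬b ¬x F {ℓ} ℓ∈C =
      trans (value-cong ℓ (extend-move (var ℓ) (¬b ℓ∈C) (¬x ℓ∈C))) (F ℓ∈C)

-- Axioms away from the bottom hold

module _ {m} (ω : Vec State (2 + m)) where

  private
    top : Fin (2 + m)
    top = fromℕ (suc m)

  open Descent

  -- On kept elements `L` compares ranks, which settles `irreflexive` and `transitive`. In `witness`
  -- and `smaller` the element j is touched, so it is not the bottom and, if kept, has a kept
  -- witness of larger rank.
  ¬falsified-axiom : ∀ (d : Descent top ω) {C} → RLNP (2 + m) C →
                     Untouched (bottom d) C → ¬ Falsified (extend top ω d) C
  ¬falsified-axiom d (irreflexive i) _ F = n≮n (rank d i) (<ᵇ≡true⇒< (trans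
    (sym (extend-L top ω d i i ki ki)) (not-injective (F (there (here refl))))))
    where
    ki : Kept top ω i
    ki = not-injective (F (here refl))
  ¬falsified-axiom d (transitive i j l) _ F =
    contradiction (<-trans l<j j<i) (≤⇒≯ (<ᵇ≡false⇒≥ (trans
      (sym (extend-L top ω d i l ki kl))
      (F (there (there (there (there (there (here refl))))))))))
    where
    ki : Kept top ω i
    ki = not-injective (F (here refl))
    kj : Kept top ω j
    kj = not-injective (F (there (here refl)))
    kl : Kept top ω l
    kl = not-injective (F (there (there (here refl))))
    j<i : rank d j < rank d i
    j<i = <ᵇ≡true⇒< (trans (sym (extend-L top ω d i j ki kj))
      (not-injective (F (there (there (there (here refl)))))))
    l<j : rank d l < rank d j
    l<j = <ᵇ≡true⇒< (trans (sym (extend-L top ω d j l kj kl))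
      (not-injective (F (there (there (there (there (here refl))))))))
  ¬falsified-axiom d (witness j) U F = by (kept (status top ω j)) refl
    where
    S-false : ∀ i → extend top ω d (S i j) ≡ false
    S-false i = F (∈-tabulate⁺ {f = λ i → pos (S i j)} i)
    by : ∀ b → kept (status top ω j) ≡ b → ⊥
    by true kj =
      let kw , _ = descends d kj λ { refl → U (here refl) (inj₁ refl) }
      in  true≢false (trans (extend-S top ω d (witnessOf d j) j kw kj)
                            (dec-true (witnessOf d j ≟ witnessOf d j) refl))
                     (S-false (witnessOf d j))
    -- For a dropped j, `S zero j` and `S (suc zero) j` take opposite values; this is where two
    -- elements are needed, hence `2 + m`.
    by false ¬kj = xor-both (row (status top ω j)) (row-xor zero) (row-xor (suc zero))
      where
      row-xor : ∀ i → row (status top ω j) xor isZero i ≡ false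
      row-xor i = trans (cong (fromMaybe (guess top ω d (S i j))) (sym restricted)) (S-false i)
        where
        restricted : restrict top ω (S i j) ≡ just (row (status top ω j) xor isZero i)
        restricted rewrite ¬kj = refl
      xor-both : ∀ b → b xor true ≡ false → b xor false ≡ false → ⊥
      xor-both true  _ ()
      xor-both false () _
  ¬falsified-axiom d (relativized i j) _ F = true≢false
    (not-injective (F (here refl))) S-false
    where
    kj : Kept top ω j
    kj = not-injective (F (there (here refl)))
    S-false : extend top ω d (S i j) ≡ false
    S-false rewrite kj | F (there (there (here refl))) = refl
  ¬falsified-axiom d (smaller i j) U F = by (kept (status top ω i)) refl
    where
    kj : Kept top ω j
    kj = not-injective (F (there (here refl)))
    S-true : extend top ω d (S i j) ≡ true
    S-true = not-injective (F (here refl))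
    by : ∀ b → kept (status top ω i) ≡ b → ⊥
    by false ¬ki = true≢false S-true S-false
      where
      S-false : extend top ω d (S i j) ≡ false
      S-false rewrite kj | ¬ki = refl
    by true ki = contradiction j<i (≤⇒≯ (<ᵇ≡false⇒≥
      (trans (sym (extend-L top ω d i j ki kj)) (F (there (there (here refl)))))))
      where
      w≡i : witnessOf d j ≡ i
      w≡i = does-true⇒ (witnessOf d j ≟ i) (trans (sym (extend-S top ω d i j ki kj)) S-true)
      j<i : rank d j < rank d i
      j<i = subst (λ y → rank d j < rank d y) w≡i
        (proj₂ (descends d kj λ { refl → U (here refl) (inj₁ refl) }))
  ¬falsified-axiom d (nonempty i i≡top) _ F = true≢false top-kept (F (here refl))
    where
    top-kept : Kept top ω i
    top-kept rewrite dec-true (i ≟ top)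
      (toℕ-injective (trans (suc-injective i≡top) (sym (toℕ-fromℕ (suc m))))) = refl

-- Survival probability of wide clauses

^-distribʳ-* : ∀ k m n → (m * n) ^ k ≡ m ^ k * n ^ k
^-distribʳ-* zero    m n = refl
^-distribʳ-* (suc k) m n =
  trans (cong (m * n *_) (^-distribʳ-* k m n)) (lemma m n (m ^ k) (n ^ k))
  where
  lemma : ∀ m n u v → m * n * (u * v) ≡ m * u * (n * v)
  lemma = solve-∀

module _ (top : Fin n) (t : ℕ) where

  wide : Clause (Var n) → Bool
  wide C = (t <ᵇ ∣ support top high C ∣) ∨ (t <ᵇ ∣ support top low C ∣)

  bad : Clause (Var n) → Vec State n → Bool
  bad C ω = wide C ∧ unsatisfied top C ω

  wide-false : ∀ C → wide C ≡ false →
               ∣ support top high C ∣ ≤ t × ∣ support top low C ∣ ≤ t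
  wide-false C eq with t <ᵇ ∣ support top high C ∣ in eq₁
  ... | false = <ᵇ≡false⇒≥ eq₁ , <ᵇ≡false⇒≥ eq

  -- Relaxes (7/8)^∣X∣ to (7/8)^t with denominators cleared, giving all wide clauses the same bound.
  total-unsatisfied : ∀ {C} (X : Subset n) → t < ∣ X ∣ →
    total n (𝟙 ∘ unsatisfied top C) * 8 ^ ∣ X ∣ ≤ 7 ^ ∣ X ∣ * 8 ^ n →
    total n (𝟙 ∘ unsatisfied top C) * 8 ^ t ≤ 7 ^ t * 8 ^ n
  total-unsatisfied {C} X t<X bound with e , t+e≡X ← m≤n⇒∃[o]m+o≡n (<⇒≤ t<X) =
    *-cancelʳ-≤ _ _ (8 ^ e) {{m^n≢0 8 e}} (begin
      τ * 8 ^ t * 8 ^ e          ≡⟨ *-assoc τ _ _ ⟩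
      τ * (8 ^ t * 8 ^ e)        ≡⟨ cong (τ *_) (^-distribˡ-+-* 8 t e) ⟨
      τ * 8 ^ (t + e)            ≤⟨ subst (λ k → τ * 8 ^ k ≤ 7 ^ k * 8 ^ n) (sym t+e≡X) bound ⟩
      7 ^ (t + e) * 8 ^ n        ≡⟨ cong (_* 8 ^ n) (^-distribˡ-+-* 7 t e) ⟩
      7 ^ t * 7 ^ e * 8 ^ n      ≤⟨ *-monoˡ-≤ (8 ^ n) (*-monoʳ-≤ (7 ^ t) (^-monoˡ-≤ e (n≤1+n 7))) ⟩
      7 ^ t * 8 ^ e * 8 ^ n      ≡⟨ lemma (7 ^ t) (8 ^ e) (8 ^ n) ⟩
      7 ^ t * 8 ^ n * 8 ^ e      ∎)
    where
    open ≤-Reasoning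
    τ = total n (𝟙 ∘ unsatisfied top C)
    lemma : ∀ u v w → u * v * w ≡ u * w * v
    lemma = solve-∀

  total-bad : ∀ C → total n (𝟙 ∘ bad C) * 8 ^ t ≤ 7 ^ t * 8 ^ n
  total-bad C with t <ᵇ ∣ support top high C ∣ in eq₁
  ... | true = total-unsatisfied {C} (support top high C) (<ᵇ≡true⇒< eq₁)
        (total-blocked-< n _ _ (blocks-high top {C}))
  ... | false with t <ᵇ ∣ support top low C ∣ in eq₂
  ...   | true = total-unsatisfied {C} (support top low C) (<ᵇ≡true⇒< eq₂)
        (total-blocked-> n _ _ (blocks-low top {C}))
  ...   | false rewrite total-zero n {const 0} (λ _ → refl) = z≤n

-- The walk through the refutation and the union bound

module _ {m} (π : Refutation (RLNP (2 + m))) (t : ℕ) where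

  open Refutation π
  open Descent

  private
    top : Fin (2 + m)
    top = fromℕ (suc m)

    threshold : ℕ
    -- One more than the number of elements that `fresh` may have to avoid.
    threshold = 4 + (t + t)

  module _ (ω : Vec State (2 + m)) (kept≥ : threshold ≤ ∣ keptSet ω ∣)
           (¬bad : ∀ i → bad top t (label i) ω ≡ false) where

    -- Quantified over all descents, because the walk changes the descent at every resolution step.
    Refutes : Clause (Var (2 + m)) → Set
    Refutes C = (d : Descent top ω) → Untouched (bottom d) C → ¬ Falsified (extend top ω d) C

    refutes-node : ∀ v → (∀ {j} → v ≡ internal j → Refutes (label j)) → Refutes (clauseAt label v)
    refutes-node (source ax)  _   d = ¬falsified-axiom ω d ax
    refutes-node (internal j) rec = rec refl

    -- A falsified label is not satisfied by the restriction; not being bad, it cannot be wide.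
    narrow : ∀ i d → Falsified (extend top ω d) (label i) →
             ∣ support top high (label i) ∣ ≤ t × ∣ support top low (label i) ∣ ≤ t
    narrow i d F = wide-false top t (label i) (not-wide (¬bad i))
      where
      not-wide : ∀ {b} → b ∧ unsatisfied top (label i) ω ≡ false → b ≡ false
      not-wide {false} _  = refl
      not-wide {true}  eq = contradiction eq
        (true≢false (falsified⇒unsatisfied top ω d (label i) F))

    refutes-label : ∀ i → Acc _<ᶠ_ i → Refutes (label i)
    refutes-label i (acc rs) d U F with rule i in eq
    -- The premise lies inside the conclusion, so the descent can stay as it is.
    ... | weakening p ℓ E≈ = refutes-node p
          (λ p≡j → refutes-label _ (rs (acyclic
            (subst (λ r → _ ∈ premises r) (sym eq) (here (sym p≡j))))))
          d (U ∘ from E≈ ∘ there) (F ∘ from E≈ ∘ there)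
    ... | resolution p q P Q v p≈ q≈ E≈
      with high≤ , low≤ ← narrow i d F
      -- The pivot `v` may touch the current bottom, so the bottom first moves to an x touched by
      -- neither `v` nor the conclusion.
      with x , x∈ , x≢top , x∤v , x∤E ← fresh top {A = keptSet ω} v high≤ low≤ kept≥
      = by (extend top ω d′ v) refl
      where
      -- `keptSet` records the drawn states, which are the actual ones away from `top`.
      x-kept : Kept top ω x
      x-kept = trans (cong kept (status-≢ top {ω} x≢top))
                     (trans (sym (lookup-map x kept ω)) ([]=⇒lookup x∈))
      d′ : Descent top ω
      d′ = move top ω d x-kept
      F′ : Falsified (extend top ω d′) (label i)
      F′ = falsified-move top ω d x-kept U x∤E F
      P⊆E : ∀ {ℓ} → ℓ ∈ P → ℓ ∈ label i
      P⊆E = from E≈ ∘ ∈-++⁺ˡ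
      Q⊆E : ∀ {ℓ} → ℓ ∈ Q → ℓ ∈ label i
      Q⊆E = from E≈ ∘ ∈-++⁺ʳ P
      -- The pivot is evaluated after the move, which may have changed its value; the walk goes to
      -- the premise whose pivot literal is false.
      by : ∀ b → extend top ω d′ v ≡ b → ⊥
      by false v-false = refutes-node p
        (λ p≡j → refutes-label _ (rs (acyclic
            (subst (λ r → _ ∈ premises r) (sym eq) (here (sym p≡j))))))
        d′ (Up ∘ to p≈) (Fp ∘ to p≈)
        where
        Up : Untouched x (pos v ∷ P)
        Up (here refl) = x∤v
        Up (there ℓ∈P) = x∤E (P⊆E ℓ∈P)
        Fp : Falsified (extend top ω d′) (pos v ∷ P)
        Fp (here refl) = v-false
        Fp (there ℓ∈P) = F′ (P⊆E ℓ∈P)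
      by true v-true = refutes-node q
        (λ q≡j → refutes-label _ (rs (acyclic
            (subst (λ r → _ ∈ premises r) (sym eq) (there (here (sym q≡j)))))))
        d′ (Uq ∘ to q≈) (Fq ∘ to q≈)
        where
        Uq : Untouched x (neg v ∷ Q)
        Uq (here refl) = x∤v
        Uq (there ℓ∈Q) = x∤E (Q⊆E ℓ∈Q)
        Fq : Falsified (extend top ω d′) (neg v ∷ Q)
        Fq (here refl) = cong not v-true
        Fq (there ℓ∈Q) = F′ (Q⊆E ℓ∈Q)

    no-refutation : ⊥
    no-refutation = refutes-node root (λ _ → refutes-label _ (<ᶠ-wellFounded _))
      (initial top ω) (λ ℓ∈ → contradiction (in-[] ℓ∈) λ ())
      (λ ℓ∈ → contradiction (in-[] ℓ∈) λ ())
      where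
      in-[] : ∀ {ℓ} → ℓ ∈ clauseAt label root → ℓ ∈ []
      in-[] = subst (_ ∈_) root-empty

  some-event : ∀ ω → 1 ≤ 𝟙 (∣ keptSet ω ∣ <ᵇ threshold) +
                         ∑ (allFin size) (λ i → 𝟙 (bad top t (label i) ω))
  some-event ω with ∣ keptSet ω ∣ <ᵇ threshold in few
  ... | true  = s≤s z≤n
  ... | false with anyFin? (λ i → bad top t (label i) ω Bool.≟ true)
  ...   | yes (i , bad-i) = ≤-trans (≤-reflexive (cong 𝟙 (sym bad-i)))
                              (∈⇒≤∑ (λ i → 𝟙 (bad top t (label i) ω)) (∈-allFin i))
  ...   | no none = contradiction
          (no-refutation ω (<ᵇ≡false⇒≥ few) (λ i → ¬-not λ b → none (i , b))) λ ()

  -- Sums `some-event` over all ω, scaled by `8 ^ t` to clear the denominator of (7/8)^t.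
  counting : 8 ^ (2 + m) * 8 ^ t ≤
             6 ^ (2 + m) * 2 ^ threshold * 8 ^ t + size * (7 ^ t * 8 ^ (2 + m))
  counting = begin
    8 ^ N * 8 ^ t                              ≡⟨ cong (_* 8 ^ t) (total-one N) ⟨
    total N (const 1) * 8 ^ t                  ≤⟨ *-monoˡ-≤ (8 ^ t) (total-mono N some-event) ⟩
    total N (λ ω → f ω + g ω) * 8 ^ t          ≡⟨ cong (_* 8 ^ t) (total-+ N f g) ⟩
    (total N f + total N g) * 8 ^ t            ≡⟨ *-distribʳ-+ (8 ^ t) (total N f) (total N g) ⟩
    total N f * 8 ^ t + total N g * 8 ^ t      ≤⟨ +-mono-≤ (*-monoˡ-≤ (8 ^ t) (total-few-kept N threshold)) g≤ ⟩
    6 ^ N * 2 ^ threshold * 8 ^ t + size * (7 ^ t * 8 ^ N) ∎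
    where
    open ≤-Reasoning
    N = 2 + m
    f g : Vec State N → ℕ
    f ω = 𝟙 (∣ keptSet ω ∣ <ᵇ threshold)
    g ω = ∑ (allFin size) (λ i → 𝟙 (bad top t (label i) ω))
    h : Fin size → ℕ
    h i = total N (𝟙 ∘ bad top t (label i))
    g≤ : total N g * 8 ^ t ≤ size * (7 ^ t * 8 ^ N)
    g≤ = begin
      total N g * 8 ^ t
        ≡⟨ cong (_* 8 ^ t) (total-∑ N (allFin size) λ i ω → 𝟙 (bad top t (label i) ω)) ⟩
      ∑ (allFin size) h * 8 ^ t
        ≤⟨ ∑-≤ (allFin size) h (λ i → total-bad top t (label i)) ⟩
      length (allFin size) * (7 ^ t * 8 ^ N)
        ≡⟨ cong (_* (7 ^ t * 8 ^ N)) (length-tabulate {n = size} (λ i → i)) ⟩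
      size * (7 ^ t * 8 ^ N) ∎

-- Choice of constants

-- 4 · 6⁵ ≤ 8⁵
6^≤8^ : ∀ t n → 5 * (3 + t) ≤ n → 2 * (6 ^ n * 2 ^ (4 + (t + t))) ≤ 8 ^ n
6^≤8^ t n ≤n with r , refl ← m≤n⇒∃[o]m+o≡n ≤n = begin
  2 * (6 ^ (5 * k + r) * 2 ^ (4 + (t + t)))  ≡⟨ swap (6 ^ (5 * k + r)) _ ⟩
  6 ^ (5 * k + r) * 2 ^ (5 + (t + t))        ≤⟨ *-monoʳ-≤ (6 ^ (5 * k + r)) (^-monoʳ-≤ 2 exponent) ⟩
  6 ^ (5 * k + r) * 2 ^ (2 * k)              ≡⟨ cong₂ _*_ (^-distribˡ-+-* 6 (5 * k) r) (sym (^-*-assoc 2 2 k)) ⟩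
  6 ^ (5 * k) * 6 ^ r * 4 ^ k                ≡⟨ cong (λ z → z * 6 ^ r * 4 ^ k) (sym (^-*-assoc 6 5 k)) ⟩
  7776 ^ k * 6 ^ r * 4 ^ k                   ≡⟨ rearrange (7776 ^ k) (6 ^ r) (4 ^ k) ⟩
  4 ^ k * 7776 ^ k * 6 ^ r                   ≡⟨ cong (_* 6 ^ r) (^-distribʳ-* k 4 7776) ⟨
  31104 ^ k * 6 ^ r                          ≤⟨ *-mono-≤ (^-monoˡ-≤ k (≤ᵇ⇒≤ 31104 32768 _)) (^-monoˡ-≤ r (≤ᵇ⇒≤ 6 8 _)) ⟩
  32768 ^ k * 8 ^ r                          ≡⟨ cong (_* 8 ^ r) (^-*-assoc 8 5 k) ⟩
  8 ^ (5 * k) * 8 ^ r                        ≡⟨ ^-distribˡ-+-* 8 (5 * k) r ⟨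
  8 ^ (5 * k + r)                            ∎
  where
  open ≤-Reasoning
  k = 3 + t
  exponent : 5 + (t + t) ≤ 2 * k
  exponent = ≤-trans (n≤1+n _) (≤-reflexive (lemma t))
    where
    lemma : ∀ t → 6 + (t + t) ≡ 2 * (3 + t)
    lemma = solve-∀
  swap : ∀ u v → 2 * (u * v) ≡ u * (2 * v)
  swap = solve-∀
  rearrange : ∀ u v w → u * v * w ≡ w * u * v
  rearrange = solve-∀

-- Take t = 6k. By `6^≤8^` at most half of all ω keep few elements, so surviving wide clauses
-- account for the other half: size · (7/8)^t is at least 1/2, while (7/8)^t is at most 2^(-k).
size-bound : ∀ k m (π : Refutation (RLNP (2 + m))) → 5 * (3 + 6 * k) ≤ 2 + m →
             2 ^ k ≤ 2 * Refutation.size π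
size-bound k m π ≤n = *-cancelʳ-≤ _ _ (7 ^ t) {{m^n≢0 7 t}} (*-cancelʳ-≤ _ _ (8 ^ N) {{m^n≢0 8 N}}
  (begin
    2 ^ k * 7 ^ t * 8 ^ N   ≤⟨ *-monoˡ-≤ (8 ^ N) 14≤ ⟩
    8 ^ t * 8 ^ N           ≤⟨ +-cancelˡ-≤ (8 ^ t * 8 ^ N) _ _ doubled ⟩
    2 * s * 7 ^ t * 8 ^ N   ∎))
  where
  open ≤-Reasoning
  N = 2 + m
  t = 6 * k
  s = Refutation.size π
  few = 6 ^ N * 2 ^ (4 + (t + t))
  -- 2 · 7⁶ ≤ 8⁶
  14≤ : 2 ^ k * 7 ^ t ≤ 8 ^ t
  14≤ = begin
    2 ^ k * 7 ^ t        ≡⟨ cong (2 ^ k *_) (sym (^-*-assoc 7 6 k)) ⟩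
    2 ^ k * 117649 ^ k   ≡⟨ ^-distribʳ-* k 2 117649 ⟨
    235298 ^ k           ≤⟨ ^-monoˡ-≤ k (≤ᵇ⇒≤ 235298 262144 _) ⟩
    262144 ^ k           ≡⟨ ^-*-assoc 8 6 k ⟩
    8 ^ t                ∎
  lemma₁ : ∀ u v → u * v + u * v ≡ 2 * (v * u)
  lemma₁ = solve-∀
  lemma₂ : ∀ f u s v w → 2 * (f * u + s * (v * w)) ≡ u * (2 * f) + 2 * s * v * w
  lemma₂ = solve-∀
  doubled : 8 ^ t * 8 ^ N + 8 ^ t * 8 ^ N ≤ 8 ^ t * 8 ^ N + 2 * s * 7 ^ t * 8 ^ N
  doubled = begin
    8 ^ t * 8 ^ N + 8 ^ t * 8 ^ N                 ≡⟨ lemma₁ (8 ^ t) (8 ^ N) ⟩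
    2 * (8 ^ N * 8 ^ t)                           ≤⟨ *-monoʳ-≤ 2 (counting π t) ⟩
    2 * (few * 8 ^ t + s * (7 ^ t * 8 ^ N))       ≡⟨ lemma₂ few (8 ^ t) s (7 ^ t) (8 ^ N) ⟩
    8 ^ t * (2 * few) + 2 * s * 7 ^ t * 8 ^ N     ≤⟨ +-monoˡ-≤ _ (*-monoʳ-≤ (8 ^ t) (6^≤8^ t N ≤n)) ⟩
    8 ^ t * 8 ^ N + 2 * s * 7 ^ t * 8 ^ N         ∎

2^≤-^ : ∀ {a n s} q → 2 ^ a ≤ s → n ≤ a * q → 2 ^ n ≤ s ^ q
2^≤-^ {a} {n} {s} q 2^a≤s n≤aq = begin
  2 ^ n        ≤⟨ ^-monoʳ-≤ 2 n≤aq ⟩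
  2 ^ (a * q)  ≡⟨ ^-*-assoc 2 a q ⟨
  (2 ^ a) ^ q  ≤⟨ ^-monoˡ-≤ q 2^a≤s ⟩
  s ^ q        ∎
  where open ≤-Reasoning

size-bound-60 : ∀ n → 150 ≤ n → (π : Refutation (RLNP n)) →
                ∃ λ a → 2 ^ a ≤ Refutation.size π × n ≤ a * 60
size-bound-60 (suc zero) (s≤s ()) π
size-bound-60 (suc (suc m)) 150≤n π with k , 5+k≡q ← m≤n⇒∃[o]m+o≡n (/-monoˡ-≤ 30 150≤n) =
  -- One unit of `4 + k` pays for the factor 2 in `size-bound`. With q = n / 30 = 5 + k, the
  -- exponent is q - 2, and 30(q + 1) ≤ 60(q - 2) holds from q = 5 on, whence 150.
  3 + k , *-cancelˡ-≤ 2 (size-bound (4 + k) m π large) , exponent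
  where
  open ≤-Reasoning
  N = 2 + m
  N≡ : N ≡ N % 30 + (5 + k) * 30
  N≡ = trans (m≡m%n+[m/n]*n N 30) (cong (λ q → N % 30 + q * 30) (sym 5+k≡q))
  large : 5 * (3 + 6 * (4 + k)) ≤ N
  large = begin
    5 * (3 + 6 * (4 + k))       ≤⟨ m≤n+m _ 15 ⟩
    15 + 5 * (3 + 6 * (4 + k))  ≡⟨ lemma k ⟩
    (5 + k) * 30                ≤⟨ m≤n+m _ (N % 30) ⟩
    N % 30 + (5 + k) * 30       ≡⟨ N≡ ⟨
    N                           ∎
    where
    lemma : ∀ k → 15 + 5 * (3 + 6 * (4 + k)) ≡ (5 + k) * 30
    lemma = solve-∀
  exponent : N ≤ (3 + k) * 60
  exponent = begin
    N                             ≡⟨ N≡ ⟩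
    N % 30 + (5 + k) * 30         ≤⟨ +-monoˡ-≤ _ (<⇒≤ (m%n<n N 30)) ⟩
    30 + (5 + k) * 30             ≤⟨ m≤m+n _ (30 * k) ⟩
    30 + (5 + k) * 30 + 30 * k    ≡⟨ lemma k ⟩
    (3 + k) * 60                  ∎
    where
    lemma : ∀ k → 30 + (5 + k) * 30 + 30 * k ≡ (3 + k) * 60
    lemma = solve-∀

proposition2 : Σ[ c ∈ ℚ ] Positive c × (Σ[ N ∈ ℕ ] (∀ n → N ≤ n → (π : Refutation (RLNP n)) → 2^[ c · n ]≤ (Refutation.size π)))
proposition2 = ℤ.+ 1 ℚ./ 60 , _ , 150 , λ n 150≤n π →
  let a , 2^a≤s , n≤a*60 = size-bound-60 n 150≤n π
  in  2^≤-^ {a} 60 2^a≤s (≤-trans (≤-reflexive (*-identityˡ n)) n≤a*60)
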